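{- Let $\mathcal{F}_t$ be the family of forests. Then the game $BS_n(\mathcal{F}_t : t_1, t_2, \dots, t_n)$ ends after exactly $n-1$ moves.
   Context: A set of graphs $\mathcal{F}$ is a hereditary class if every graph isomorphic to an induced subgraph of a graph in $\mathcal{F}$ belongs to $\mathcal{F}$. For a hereditary class $\mathcal{F}$, the game $BS_n(\mathcal{F}:t_1,\dots,t_n)$ ($n$-Brussels sprout for $\mathcal{F}$ with parameters $(t_1,\dots,t_n)$) is the following two-player pen and paper game. It starts with $n$ spots having $t_1, \dots, t_n$ open tips (free partial edges coming out of the spot), respectively. The players move alternately. A valid move consists of joining two open tips with a curve, followed by drawing a crossbar on the curve to create two new open tips. The graph obtained by taking the spots and the intersections of a curve and a crossbar as vertices, and the curves joining two such vertices as edges, must remain inside the family $\mathcal{F}$ at all times. The first player unable to provide a valid move loses. The number of moves is the total number of moves made by both players.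
   Formalization: The formal statement assumes n ≥ 1 and that every spot starts with at least one open tip (t_i ≥ 1); without this the claim fails, e.g. for n = 2 and t = (0,0) no move is possible although n−1 = 1. -}

module Defs where

open import Data.Fin.Base using (Fin; zero; suc)
open import Data.Fin.Properties using (_≟_)
open import Data.List.Base using (List; []; _∷_; map)
open import Data.List.Relation.Unary.Unique.Propositional using (Unique)
open import Data.List.Relation.Unary.Unique.Propositional.Properties using (map⁺)
open import Data.Nat.Base using (ℕ; zero; suc; _∸_)
open import Data.Product.Base using (Σ-syntax; ∃-syntax; _×_; _,_)
open import Data.Sum.Base using (_⊎_)
open import Function.Definitions using (Injective)
open import Relation.Binary.PropositionalEquality using (_≡_; _≢_; refl; sym; cong; subst)
open import Relation.Nullary.Decidable.Core using (yes; no)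
open import Relation.Nullary.Negation.Core using (¬_)

-- Finite undirected multigraphs.  Parallel edges have to be allowed: joining
-- two tips of the same spot creates a pair of parallel edges.  The order in
-- which `ends` lists the two ends of an edge is irrelevant (see `Joins`).

record Graph : Set where
  field
    order : ℕ
    size  : ℕ
    ends  : Fin size → Fin order × Fin order

  Vertex : Set
  Vertex = Fin order

  Edge : Set
  Edge = Fin size

  Joins : Edge → Vertex → Vertex → Set
  Joins e u v = ends e ≡ (u , v) ⊎ ends e ≡ (v , u)

open Graph public using (Vertex; Edge; Joins)

-- H is isomorphic to an induced subgraph of G.

record InducedEmbedding (H G : Graph) : Set where
  field
    onV      : Vertex H → Vertex G
    onE      : Edge H → Edge G
    onV-inj  : Injective _≡_ _≡_ onV
    onE-inj  : Injective _≡_ _≡_ onE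
    incident : ∀ {e u v} → Joins H e u v → Joins G (onE e) (onV u) (onV v)
    induced  : ∀ {e′ u v} → Joins G e′ (onV u) (onV v) → ∃[ e ] onE e ≡ e′

record HereditaryClass : Set₁ where
  field
    Member     : Graph → Set
    hereditary : ∀ {H G} → InducedEmbedding H G → Member G → Member H

open HereditaryClass public using (Member)

data Walk (G : Graph) : Vertex G → Vertex G → Set where
  []  : ∀ {u} → Walk G u u
  _∷_ : ∀ {e u v w} → Joins G e u v → Walk G v w → Walk G u w

edges : ∀ {G u v} → Walk G u v → List (Edge G)
edges []            = []
edges (_∷_ {e} _ p) = e ∷ edges p

-- The final vertex of the walk is left out, so that on a closed walk the base
-- point is listed once.

vertices : ∀ {G u v} → Walk G u v → List (Vertex G)
vertices []                = []
vertices (_∷_ {u = u} _ p) = u ∷ vertices p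

-- A loop is a cycle of length 1 and two parallel edges form a cycle of length
-- 2; distinctness of the edges excludes going back and forth along one edge.

record Cycle (G : Graph) : Set where
  field
    {base}            : Vertex G
    walk              : Walk G base base
    nonempty          : edges walk ≢ []
    distinct-vertices : Unique (vertices walk)
    distinct-edges    : Unique (edges walk)

Forest : Graph → Set
Forest G = ¬ Cycle G

module _ {H G : Graph} (ι : InducedEmbedding H G) where
  open InducedEmbedding ι

  mapWalk : ∀ {u v} → Walk H u v → Walk G (onV u) (onV v)
  mapWalk []      = []
  mapWalk (j ∷ p) = incident j ∷ mapWalk p

  edges-mapWalk : ∀ {u v} (p : Walk H u v) → edges (mapWalk p) ≡ map onE (edges p)
  edges-mapWalk []            = refl
  edges-mapWalk (_∷_ {e} _ p) = cong (onE e ∷_) (edges-mapWalk p)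

  vertices-mapWalk : ∀ {u v} (p : Walk H u v) → vertices (mapWalk p) ≡ map onV (vertices p)
  vertices-mapWalk []                = refl
  vertices-mapWalk (_∷_ {u = u} _ p) = cong (onV u ∷_) (vertices-mapWalk p)

  mapWalk-nonempty : ∀ {u v} (p : Walk H u v) → edges p ≢ [] → edges (mapWalk p) ≢ []
  mapWalk-nonempty []      ne _ = ne refl
  mapWalk-nonempty (_ ∷ _) _ ()

  mapCycle : Cycle H → Cycle G
  mapCycle c = record
    { walk              = mapWalk walk
    ; nonempty          = mapWalk-nonempty walk nonempty
    ; distinct-vertices = subst Unique (sym (vertices-mapWalk walk)) (map⁺ onV-inj distinct-vertices)
    ; distinct-edges    = subst Unique (sym (edges-mapWalk walk)) (map⁺ onE-inj distinct-edges)
    }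
    where open Cycle c

forests : HereditaryClass
forests = record
  { Member     = Forest
  ; hereditary = λ ι acyclic c → acyclic (mapCycle ι c)
  }

record Position : Set where
  field
    graph : Graph
    tips  : Vertex graph → ℕ

  Tip : Set
  Tip = Σ[ v ∈ Vertex graph ] Fin (tips v)

open Position public using (graph; tips; Tip)

edgeless : ℕ → Graph
edgeless n = record { order = n ; size = 0 ; ends = λ () }

start : ∀ {n} → (Fin n → ℕ) → Position
start {n} t = record { graph = edgeless n ; tips = t }

-- A curve from u to v whose crossbar is the new vertex `zero`; the old vertices
-- and edges are shifted.

addCurve : (G : Graph) → Vertex G → Vertex G → Graph
addCurve G u v = record
  { order = suc (Graph.order G)
  ; size  = suc (suc (Graph.size G))
  ; ends  = λ { zero          → suc u , zero
              ; (suc zero)    → zero , suc v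
              ; (suc (suc e)) → let (x , y) = Graph.ends G e in suc x , suc y
              }
  }

useTip : ∀ {n} → Fin n → (Fin n → ℕ) → (Fin n → ℕ)
useTip u t x with x ≟ u
... | yes _ = t x ∸ 1
... | no  _ = t x

join : (s : Position) → Tip s → Tip s → Position
join s (u , _) (v , _) = record
  { graph = addCurve (graph s) u v
  ; tips  = λ { zero    → 2
              ; (suc x) → useTip v (useTip u (tips s)) x
              }
  }

-- The moves available do not depend on whose turn it is, so players are not
-- recorded.

record ValidMove (F : HereditaryClass) (s : Position) : Set where
  field
    tip₁ tip₂ : Tip s
    distinct  : tip₁ ≢ tip₂
    remains   : Member F (graph (join s tip₁ tip₂))

  result : Position
  result = join s tip₁ tip₂

-- However the two players play from position s, the game lasts exactly k moves.

EndsAfterExactly : HereditaryClass → ℕ → Position → Set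
EndsAfterExactly F zero    s = ¬ ValidMove F s
EndsAfterExactly F (suc k) s =
  ValidMove F s × ((m : ValidMove F s) → EndsAfterExactly F k (ValidMove.result m))

BSEndsAfterExactly : (F : HereditaryClass) (n : ℕ) (t : Fin n → ℕ) (k : ℕ) → Set
BSEndsAfterExactly F n t k = EndsAfterExactly F k (start t)

{-# OPTIONS --safe #-}
module Submission where

-- As long as the graph is a forest, a move must join tips in two different
-- components: within one component the new curve closes a path to a cycle.
-- Conversely, joining two components creates no cycle, since both halves of
-- the curve are bridges.  So every move lowers the number of components by
-- one, starting from n.  Every component keeps an open tip, since the crossbar
-- supplies new ones to the merged component; hence a move exists until
-- a single component is left.

open import Data.Empty using (⊥-elim)
open import Data.Fin.Base using (Fin; zero; suc; fromℕ<; punchIn; punchOut)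
open import Data.Fin.Properties
  using (_≟_; 0≢1+n; suc-injective; punchInᵢ≢i; punchOut-cong; punchOut-injective; punchOut-punchIn)
open import Data.List.Base using ([]; _∷_; map)
import Data.List.Membership.DecPropositional as DecMembership
open import Data.List.Membership.Propositional using (_∈_; _∉_)
open import Data.List.Relation.Unary.All using ([]; _∷_; universal)
open import Data.List.Relation.Unary.All.Properties as All using (¬Any⇒All¬; All¬⇒¬Any)
open import Data.List.Relation.Unary.AllPairs using ([]; _∷_)
open import Data.List.Relation.Unary.Any using (here; there)
open import Data.List.Relation.Unary.Unique.Propositional using (Unique)
open import Data.List.Relation.Unary.Unique.Propositional.Properties using (map⁺; map⁻)
open import Data.Nat.Base using (ℕ; zero; suc; _∸_; _≤_)
open import Data.Product.Base as Product using (Σ-syntax; ∃-syntax; _×_; _,_; proj₁; proj₂)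
open import Data.Sum.Base as Sum using (inj₁; inj₂)
open import Function.Base using (_∘_)
open import Relation.Binary.PropositionalEquality
  using (_≡_; _≢_; refl; sym; trans; cong; subst; ≢-sym)
open import Relation.Nullary.Decidable.Core using (yes; no)
open import Relation.Nullary.Negation.Core using (contradiction)
open import Defs

-- Walks and their reduction to paths.

module _ {G : Graph} where
  open DecMembership (_≟_ {Graph.order G}) using (_∈?_)

  infixr 5 _++_

  _++_ : ∀ {x y z} → Walk G x y → Walk G y z → Walk G x z
  []            ++ q = q
  (_∷_ {e} j p) ++ q = _∷_ {e = e} j (p ++ q)

  reverse : ∀ {x y} → Walk G x y → Walk G y x
  reverse []            = []
  reverse (_∷_ {e} j p) = reverse p ++ (_∷_ {e = e} (Sum.swap j) [])

  -- The end `y` is put back because `vertices` omits it. So `p` is a path, and a simple walk from a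
  -- vertex to itself is empty.
  Simple : ∀ {x y} → Walk G x y → Set
  Simple {y = y} p = Unique (y ∷ vertices p) × Unique (edges p)

  start∈ : ∀ {x y} (p : Walk G x y) → x ∈ y ∷ vertices p
  start∈ []      = here refl
  start∈ (_ ∷ _) = there (here refl)

  ∈-weaken : ∀ {A : Set} {x y z : A} {xs} → x ∈ y ∷ xs → x ∈ y ∷ z ∷ xs
  ∈-weaken (here eq)  = here eq
  ∈-weaken (there x∈) = there (there x∈)

  -- Serves `simplify`: an edge with an end off the path cannot already be on the path.
  end∈ : ∀ {x y e a b} (p : Walk G x y) → e ∈ edges p → Joins G e a b → a ∈ y ∷ vertices p
  end∈ (inj₁ refl ∷ p) (here refl) (inj₁ refl) = there (here refl)
  end∈ (inj₁ refl ∷ p) (here refl) (inj₂ refl) = ∈-weaken (start∈ p)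
  end∈ (inj₂ refl ∷ p) (here refl) (inj₁ refl) = ∈-weaken (start∈ p)
  end∈ (inj₂ refl ∷ p) (here refl) (inj₂ refl) = there (here refl)
  end∈ (_ ∷ p)         (there e∈)  j           = ∈-weaken (end∈ p e∈ j)

  suffix : ∀ {x y z} (p : Walk G x y) → Simple p → z ∈ y ∷ vertices p →
           Σ[ q ∈ Walk G z y ] Simple q
  suffix p       simple (here refl)         = [] , ([] ∷ []) , []
  suffix (j ∷ p) simple (there (here refl)) = (j ∷ p) , simple
  suffix (j ∷ p) (((_ ∷ y∉) ∷ (_ ∷ uv)) , (_ ∷ ue)) (there (there z∈)) =
    suffix p ((y∉ ∷ uv) , ue) (there z∈)

  -- If `x` already lies on the simplified rest, the loop is dropped by passing to the suffix from
  -- `x`; otherwise prepending the edge repeats neither a vertex nor an edge.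
  simplify : ∀ {x y} → Walk G x y → Σ[ q ∈ Walk G x y ] Simple q
  simplify [] = [] , ([] ∷ []) , []
  simplify (_∷_ {e} {u = x} {w = y} j p) with simplify p
  ... | q , simple@((y∉ ∷ uv) , ue) with x ∈? (y ∷ vertices q)
  ...   | yes x∈ = suffix q simple x∈
  ...   | no  x∉ = _∷_ {e = e} j q
                 , ((λ y≡x → x∉ (here (sym y≡x))) ∷ y∉) ∷ (¬Any⇒All¬ _ (x∉ ∘ there) ∷ uv)
                 , ¬Any⇒All¬ _ (λ e∈ → x∉ (end∈ q e∈ j)) ∷ ue

-- Labellings that detect bridges.

Preserves : ∀ {A : Set} (G : Graph) → (Vertex G → A) → Edge G → Set
Preserves G f e = f (proj₁ (Graph.ends G e)) ≡ f (proj₂ (Graph.ends G e))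

module _ {A : Set} {G : Graph} {f : Vertex G → A} where

  preserves⇒≡ : ∀ {e x y} → Preserves G f e → Joins G e x y → f x ≡ f y
  preserves⇒≡ eq (inj₁ refl) = eq
  preserves⇒≡ eq (inj₂ refl) = sym eq

  ≡⇒preserves : ∀ {e x y} → Joins G e x y → f x ≡ f y → Preserves G f e
  ≡⇒preserves (inj₁ refl) eq = eq
  ≡⇒preserves (inj₂ refl) eq = sym eq

  module _ {b : Edge G} (others : ∀ e → b ≢ e → Preserves G f e) where

    avoids⇒≡ : ∀ {x y} (p : Walk G x y) → b ∉ edges p → f x ≡ f y
    avoids⇒≡ []            b∉ = refl
    avoids⇒≡ (_∷_ {e} j p) b∉ =
      trans (preserves⇒≡ (others e (b∉ ∘ here)) j) (avoids⇒≡ p (b∉ ∘ there))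

    -- The stretches before and after the single use of `b` keep the label, so equal labels at `x`
    -- and `y` force equal labels at the ends of `b`. On a closed walk the labels at `x` and `y`
    -- agree trivially.
    crosses-once : ∀ {x y} (p : Walk G x y) → Unique (edges p) → b ∈ edges p →
                   f x ≡ f y → Preserves G f b
    crosses-once (j ∷ p) (b∉ ∷ _) (here refl) eq =
      ≡⇒preserves j (trans eq (sym (avoids⇒≡ p (All¬⇒¬Any b∉))))
    crosses-once (_∷_ {e} j p) (e∉ ∷ ue) (there b∈) eq =
      crosses-once p ue b∈ (trans (sym (preserves⇒≡ (others e b≢e) j)) eq)
      where
      b≢e : b ≢ e
      b≢e refl = All¬⇒¬Any e∉ b∈

-- Cycles before and after adding a curve.

module _ (G : Graph) (u v : Vertex G) where

  private
    G⁺ : Graph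
    G⁺ = addCurve G u v

  oldPart : InducedEmbedding G G⁺
  oldPart = record
    { onV      = suc
    ; onE      = λ e → suc (suc e)
    ; onV-inj  = suc-injective
    ; onE-inj  = suc-injective ∘ suc-injective
    ; incident = Sum.map (cong (Product.map suc suc)) (cong (Product.map suc suc))
    ; induced  = λ { {suc (suc e)} _ → e , refl
                   ; {zero}     (inj₁ ()) ; {zero}     (inj₂ ())
                   ; {suc zero} (inj₁ ()) ; {suc zero} (inj₂ ()) }
    }

  from-crossbar : Walk G⁺ zero (suc u)
  from-crossbar = _∷_ {e = zero} (inj₂ refl) []

  -- The two halves of the curve lead from `u` through the crossbar to `v`, and a path in `G` leads
  -- back. If `u` and `v` coincide, that path is empty and the halves are parallel edges.
  joined⇒cycle : Walk G v u → Cycle G⁺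
  joined⇒cycle p with simplify p
  ... | q , uv , ue with map⁺ suc-injective uv
  ...   | u∉ ∷ uv⁺ = record
    { walk              = _∷_ {e = zero} (inj₁ refl)
                            (_∷_ {e = suc zero} (inj₁ refl) (mapWalk oldPart q))
    ; nonempty          = λ ()
    ; distinct-vertices = subst (λ vs → Unique (suc u ∷ zero ∷ vs)) (sym (vertices-mapWalk oldPart q))
        (((λ ()) ∷ u∉) ∷ All.map⁺ (universal (λ _ ()) _) ∷ uv⁺)
    ; distinct-edges    = subst (λ es → Unique (zero ∷ suc zero ∷ es)) (sym (edges-mapWalk oldPart q))
        (((λ ()) ∷ All.map⁺ (universal (λ _ ()) _))
          ∷ All.map⁺ (universal (λ _ ()) _)
          ∷ map⁺ (suc-injective ∘ suc-injective) ue)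
    }

  restrict : ∀ {x y} (p : Walk G⁺ (suc x) (suc y)) → zero ∉ edges p → suc zero ∉ edges p →
             Σ[ q ∈ Walk G x y ] p ≡ mapWalk oldPart q
  restrict []                       0∉ 1∉ = [] , refl
  restrict (_∷_ {zero} j p)         0∉ 1∉ = ⊥-elim (0∉ (here refl))
  restrict (_∷_ {suc zero} j p)     0∉ 1∉ = ⊥-elim (1∉ (here refl))
  restrict (_∷_ {suc (suc e)} (inj₁ refl) p) 0∉ 1∉ with restrict p (0∉ ∘ there) (1∉ ∘ there)
  ... | q , refl = _∷_ {e = e} (inj₁ refl) q , refl
  restrict (_∷_ {suc (suc e)} (inj₂ refl) p) 0∉ 1∉ with restrict p (0∉ ∘ there) (1∉ ∘ there)
  ... | q , refl = _∷_ {e = e} (inj₂ refl) q , refl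

  unused⇒cycle : (c : Cycle G⁺) → zero ∉ edges (Cycle.walk c) → suc zero ∉ edges (Cycle.walk c) →
                 Cycle G
  unused⇒cycle record { base = suc x ; walk = p ; nonempty = ne
                      ; distinct-vertices = uv ; distinct-edges = ue } 0∉ 1∉
    with restrict p 0∉ 1∉
  ... | q , refl = record
    { walk              = q
    ; nonempty          = λ eq → ne (trans (edges-mapWalk oldPart q) (cong (map _) eq))
    ; distinct-vertices = map⁻ (subst Unique (vertices-mapWalk oldPart q) uv)
    ; distinct-edges    = map⁻ (subst Unique (edges-mapWalk oldPart q) ue)
    }
  -- A nonempty walk based at the crossbar would have to begin with a half of the curve.
  unused⇒cycle record { base = zero ; walk = [] ; nonempty = ne } _ _ = ⊥-elim (ne refl)
  unused⇒cycle record { base = zero ; walk = _∷_ {zero} _ _ } 0∉ _ = ⊥-elim (0∉ (here refl))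
  unused⇒cycle record { base = zero ; walk = _∷_ {suc zero} _ _ } _ 1∉ = ⊥-elim (1∉ (here refl))
  unused⇒cycle record { base = zero ; walk = _∷_ {suc (suc _)} (inj₁ ()) _ } _ _
  unused⇒cycle record { base = zero ; walk = _∷_ {suc (suc _)} (inj₂ ()) _ } _ _

  module _ {A : Set} (f : Vertex G → A) where

    extend : A → Vertex G⁺ → A
    extend a zero    = a
    extend a (suc x) = f x

    -- Each half of the curve is a bridge: labelling the crossbar like the
    -- other half's end makes that half the only edge whose ends differ.
    separated⇒forest : (∀ e → Preserves G f e) → f u ≢ f v → Forest G → Forest G⁺
    separated⇒forest preserves fu≢fv acyclic c = acyclic (unused⇒cycle c 0∉ 1∉)
      where
      open Cycle c

      0∉ : zero ∉ edges walk
      0∉ 0∈ = fu≢fv (crosses-once {f = extend (f v)} others walk distinct-edges 0∈ refl)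
        where
        others : ∀ e → zero ≢ e → Preserves G⁺ (extend (f v)) e
        others zero          0≢0 = contradiction refl 0≢0
        others (suc zero)    _   = refl
        others (suc (suc e)) _   = preserves e

      1∉ : suc zero ∉ edges walk
      1∉ 1∈ = fu≢fv (crosses-once {f = extend (f u)} others walk distinct-edges 1∈ refl)
        where
        others : ∀ e → suc zero ≢ e → Preserves G⁺ (extend (f u)) e
        others zero          _   = refl
        others (suc zero)    1≢1 = contradiction refl 1≢1
        others (suc (suc e)) _   = preserves e

-- Two vertices have the same label iff they are connected. Since `openTip` also makes `label`
-- surjective, `k` is exactly the number of components.
record Components (k : ℕ) (s : Position) : Set where
  field
    label     : Vertex (graph s) → Fin k
    preserves : ∀ e → Preserves (graph s) label e
    connected : ∀ {x y} → label x ≡ label y → Walk (graph s) x y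
    openTip   : ∀ i → Σ[ τ ∈ Tip s ] label (proj₁ τ) ≡ i
    acyclic   : Forest (graph s)

-- Merging two components by a move.

useTip-other : ∀ {n} {u x : Fin n} (t : Fin n → ℕ) → x ≢ u → useTip u t x ≡ t x
useTip-other {u = u} {x} t x≢u with x ≟ u
... | yes x≡u = contradiction x≡u x≢u
... | no  _   = refl

-- Relabelling stays within `Fin n`; the label `j` that becomes free is removed afterwards by
-- `punchOut`.
redirect : ∀ {n} → Fin n → Fin n → Fin n → Fin n
redirect i j x with x ≟ j
... | yes _ = i
... | no  _ = x

module _ {n} {i j : Fin n} where

  redirect-source : redirect i j j ≡ i
  redirect-source with j ≟ j
  ... | yes _   = refl
  ... | no  j≢j = contradiction refl j≢j

  redirect-other : ∀ {x} → x ≢ j → redirect i j x ≡ x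
  redirect-other {x} x≢j with x ≟ j
  ... | yes x≡j = contradiction x≡j x≢j
  ... | no  _   = refl

  redirect-avoids : i ≢ j → ∀ x → j ≢ redirect i j x
  redirect-avoids i≢j x with x ≟ j
  ... | yes _   = ≢-sym i≢j
  ... | no  x≢j = ≢-sym x≢j

module _ {k s} (C : Components (suc (suc k)) s) (m : ValidMove forests s) where
  open Components C
  open ValidMove m

  private
    G = graph s
    u = proj₁ tip₁
    v = proj₁ tip₂
    i = label u
    j = label v

  ends-differ : i ≢ j
  ends-differ i≡j = remains (joined⇒cycle G u v (connected (sym i≡j)))

  redirected : Vertex (graph result) → Fin (suc (suc k))
  redirected = extend G u v (redirect i j ∘ label) i

  redirected-avoids : ∀ x → j ≢ redirected x
  redirected-avoids zero    = ≢-sym ends-differ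
  redirected-avoids (suc x) = redirect-avoids ends-differ (label x)

  merged : Vertex (graph result) → Fin (suc k)
  merged x = punchOut (redirected-avoids x)

  merged-≡ : ∀ {l x} → redirected x ≡ punchIn j l → merged x ≡ l
  merged-≡ eq = trans (punchOut-cong j eq) (punchOut-punchIn j)

  redirected-preserves : ∀ e → Preserves (graph result) redirected e
  redirected-preserves zero          = redirect-other ends-differ
  redirected-preserves (suc zero)    = sym (redirect-source {j = j})
  redirected-preserves (suc (suc e)) = cong (redirect i j) (preserves e)

  -- The vertex `u` stands for the crossbar and for the former component of `v`; any other vertex
  -- stands for itself. Connectivity after the move thus reduces to `connected` before it.
  representative : ∀ x → ∃[ y ] redirected x ≡ label y × Walk (graph result) x (suc y)
  representative zero = u , refl , from-crossbar G u v
  representative (suc x) with label x ≟ j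
  ... | no  _   = x , refl , []
  ... | yes x~v = u , refl , mapWalk (oldPart G u v) (connected x~v)
                          ++ _∷_ {e = suc zero} (inj₂ refl) (from-crossbar G u v)

  merged-connected : ∀ {x y} → merged x ≡ merged y → Walk (graph result) x y
  merged-connected {x} {y} eq with representative x | representative y
  ... | x′ , x~x′ , p | y′ , y~y′ , q =
    p ++ mapWalk (oldPart G u v) (connected x′~y′) ++ reverse q
    where
    x′~y′ : label x′ ≡ label y′
    x′~y′ = trans (sym x~x′)
      (trans (punchOut-injective (redirected-avoids x) (redirected-avoids y) eq) y~y′)

  -- Before renumbering, `l` was `punchIn j l`. If this is `i`, the component is the merged one and
  -- has the tips of the crossbar.
  merged-openTip : ∀ l → Σ[ τ ∈ Tip result ] merged (proj₁ τ) ≡ l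
  merged-openTip l with i ≟ punchIn j l | openTip (punchIn j l)
  ... | yes i≡l′ | _ = (zero , zero) , merged-≡ {x = zero} i≡l′
  -- The label of `x` is neither `i` nor `j`, so `x` is neither `u` nor `v` and has lost no tip.
  ... | no  i≢l′ | (x , τ) , x~l′ =
    (suc x , subst Fin (sym unused) τ) , merged-≡ {x = suc x} (trans (redirect-other x≁v) x~l′)
    where
    x≁v : label x ≢ j
    x≁v eq = punchInᵢ≢i j l (trans (sym x~l′) eq)

    unused : useTip v (useTip u (tips s)) x ≡ tips s x
    unused = trans (useTip-other {x = x} (useTip u (tips s)) (x≁v ∘ cong label))
                   (useTip-other (tips s) λ x≡u → i≢l′ (trans (cong label (sym x≡u)) x~l′))

  mergeComponents : Components (suc k) result
  mergeComponents = record
    { label     = merged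
    ; preserves = λ e → punchOut-cong j (redirected-preserves e)
    ; connected = merged-connected
    ; openTip   = merged-openTip
    ; acyclic   = remains
    }

-- The course of the game.

connecting-move : ∀ {k s} → Components (suc (suc k)) s → ValidMove forests s
-- Any two distinct labels would do; these two exist because at least two components remain.
connecting-move {s = s} C with Components.openTip C zero | Components.openTip C (suc zero)
... | τ₁ , τ₁~0 | τ₂ , τ₂~1 = record
  { tip₁     = τ₁
  ; tip₂     = τ₂
  ; distinct = apart ∘ cong (label ∘ proj₁)
  ; remains  = separated⇒forest (graph s) (proj₁ τ₁) (proj₁ τ₂) label preserves apart acyclic
  }
  where
  open Components C

  apart : label (proj₁ τ₁) ≢ label (proj₁ τ₂)
  apart eq = 0≢1+n (trans (sym τ₁~0) (trans eq τ₂~1))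

-- With one component left, every move would close a cycle. With more, a move exists and every move
-- merges two, so the moves number one less than the components.
components⇒ends : ∀ k {s} → Components (suc k) s → EndsAfterExactly forests k s
components⇒ends zero {s} C m = remains
  (joined⇒cycle (graph s) (proj₁ tip₁) (proj₁ tip₂) (connected (one-label _ _)))
  where
  open Components C
  open ValidMove m

  one-label : (x y : Fin 1) → x ≡ y
  one-label zero zero = refl
components⇒ends (suc k) C = connecting-move C , λ m → components⇒ends k (mergeComponents C m)

startComponents : ∀ {n} (t : Fin n → ℕ) → (∀ i → 1 ≤ t i) → Components n (start t)
startComponents t 1≤t = record
  { label     = λ x → x
  ; preserves = λ ()
  ; connected = λ { refl → [] }
  ; openTip   = λ i → (i , fromℕ< (1≤t i)) , refl
  ; acyclic   = λ where
      record { walk = [] ; nonempty = ne } → ne refl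
      record { walk = _∷_ {()} _ _ }
  }

theorem2p1 : (n : ℕ) → 1 ≤ n → (t : Fin n → ℕ) → ((i : Fin n) → 1 ≤ t i)
    → BSEndsAfterExactly forests n t (n ∸ 1)
theorem2p1 (suc k) _ t 1≤t = components⇒ends k (startComponents t 1≤t)
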